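{- Each of the following families of games is neither domestic nor returnable: Rook on the set of all nonempty partitions; Queen on the set of all nonempty partitions; King on the set of all nonempty subpartitions of generalized staircases.
   Context: A partition is a finite weakly decreasing sequence $\lambda=[\lambda_1,\ldots,\lambda_r]$ of positive integers; $[\,]$ is the empty partition, and $\mathbb Y^+$ is the set of nonempty partitions. For $i,j\ge 0$, $\lambda[i,j]=[\lambda_{i+1}-j,\lambda_{i+2}-j,\ldots]$ with trailing nonpositive entries removed. For a moveset $M\subseteq \mathbb Z_{\ge0}^2\setminus\{(0,0)\}$ and $\lambda\in\mathbb Y^+$, the impartial chess game $(M,\lambda)$ starts at $\lambda$, and from a position $\mu\in\mathbb Y^+$ a player may move to $\mu[i,j]$ for any $(i,j)\in M$ with $\mu[i,j]\ne[\,]$. The positions of $(M,\lambda)$ are the partitions reachable from $\lambda$ by zero or more moves. A position is terminal if it has no moves. Movesets: King $\{(0,1),(1,0),(1,1)\}$; Rook $\{(k,0):k\ge1\}\cup\{(0,k):k\ge1\}$; Queen $\{(k,0):k\ge1\}\cup\{(0,k):k\ge1\}\cup\{(k,k):k\ge1\}$. The generalized staircase with parameters $r,c,k\ge1$ is $[(kc)^r,((k-1)c)^r,\ldots,c^r]$ (exponents denote repetition). A nonempty subpartition of a generalized staircase $\lambda$ is a partition $\lambda[i,j]\neq[\,]$ with $i,j\ge0$. The Sprague-Grundy value of a position $p$ is $\mathrm{mex}$ of the Sprague-Grundy values of the positions reachable in one move ($0$ if $p$ is terminal), where $\mathrm{mex}(S)$ is the least nonnegative integer not in $S$. The misère Grundy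 value is defined by the same mex recursion at non-terminal positions, but terminal positions have value $1$. A position with Sprague-Grundy value $t$ and misère Grundy value $\ell$ is called a $(t,\ell)$-position. A game is returnable if for any move from a $(0,1)$-position (resp. a $(1,0)$-position) to a non-terminal position $y$, there is a move from $y$ to a $(0,1)$-position (resp. to a $(1,0)$-position). A game is domestic if it has neither $(0,k)$-positions nor $(k,0)$-positions with $k\ge2$. For a moveset $M$ and a set $P\subseteq\mathbb Y^+$, the family $(M,P)$ has one of these properties if $(M,\lambda)$ has it for every $\lambda\in P$, and it does not have the property if $(M,\lambda)$ fails it for at least one $\lambda\in P$ (the failing $\lambda$ may differ for different properties). -}

module Defs where

open import Data.Empty using (⊥-elim)
open import Data.List.Base using (List; []; _∷_; _++_; drop; filter; map; replicate)
open import Data.List.Relation.Unary.All using (All)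
open import Data.List.Relation.Unary.All.Properties using (all-filter)
open import Data.List.Relation.Unary.Linked as Linked using (Linked; []; [-]; _∷_)
import Data.List.Relation.Unary.Linked.Properties as Linkedₚ
open import Data.Nat.Base using (ℕ; zero; suc; _+_; _*_; _∸_; _<_; _≤_; _≥_)
open import Data.Nat.Properties using (_<?_; ≤-trans; ∸-monoˡ-≤; <-cmp)
open import Data.Product using (Σ-syntax; ∃-syntax; _×_; _,_)
open import Relation.Binary.Construct.Closure.ReflexiveTransitive using (Star)
open import Relation.Binary.Definitions using (tri<; tri≈; tri>)
open import Relation.Binary.PropositionalEquality using (_≡_; _≢_; refl; sym; trans)
open import Relation.Nullary using (¬_)
open import Relation.Unary using (Pred; _∈_; _∉_)
open import Level using (0ℓ)

-- The proof fields are irrelevant, so that two partitions are equal as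
-- soon as their lists of parts are.
record Partition : Set where
  constructor mkPartition
  field
    parts       : List ℕ
    .decreasing : Linked _≥_ parts
    .positive   : All (0 <_) parts

open Partition public

record 𝕐⁺ : Set where
  constructor mk𝕐⁺
  field
    partition : Partition
    .nonempty : parts partition ≢ []

open 𝕐⁺ public

-- Truncated subtraction sends every entry with λₖ - j ≤ 0 to 0.  In a
-- weakly decreasing list these zeros are all trailing, so filtering out
-- the zeros removes exactly the trailing nonpositive entries.
shift : ℕ → ℕ → List ℕ → List ℕ
shift i j xs = filter (0 <?_) (map (_∸ j) (drop i xs))

drop-decreasing : ∀ i {xs} → Linked _≥_ xs → Linked _≥_ (drop i xs)
drop-decreasing zero    xs↓      = xs↓
drop-decreasing (suc i) []       = []
drop-decreasing (suc i) [-]      = drop-decreasing i []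
drop-decreasing (suc i) (_ ∷ xs↓) = drop-decreasing i xs↓

shift-decreasing : ∀ i j {xs} → Linked _≥_ xs → Linked _≥_ (shift i j xs)
shift-decreasing i j xs↓ =
  Linkedₚ.filter⁺ (0 <?_) (λ x≥y y≥z → ≤-trans y≥z x≥y)
    (Linkedₚ.map⁺ (Linked.map (∸-monoˡ-≤ j) (drop-decreasing i xs↓)))

infix 8 _[_,_]

_[_,_] : Partition → ℕ → ℕ → Partition
mkPartition xs xs↓ _ [ i , j ] =
  mkPartition (shift i j xs) (shift-decreasing i j xs↓)
    (all-filter (0 <?_) (map (_∸ j) (drop i xs)))

record Moveset : Set₁ where
  field
    cells  : Pred (ℕ × ℕ) 0ℓ
    proper : (0 , 0) ∉ cells

open Moveset public

-- As the target ν is an element of 𝕐⁺, moves to [ ] are excluded.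
Move : Moveset → 𝕐⁺ → 𝕐⁺ → Set
Move M μ ν =
  ∃[ i ] ∃[ j ] (i , j) ∈ cells M × partition ν ≡ partition μ [ i , j ]

Position : Moveset → 𝕐⁺ → Pred 𝕐⁺ 0ℓ
Position M λ₀ p = Star (Move M) λ₀ p

Terminal : Moveset → Pred 𝕐⁺ 0ℓ
Terminal M p = ∀ q → ¬ Move M p q

IsMex : Pred ℕ 0ℓ → ℕ → Set
IsMex S n = n ∉ S × (∀ m → m < n → m ∈ S)

Option : Moveset → 𝕐⁺ → Set
Option M p = Σ[ q ∈ 𝕐⁺ ] Move M p q

-- The graph of the mex recursion in which terminal positions have value
-- τ; it is single-valued by value-unique.  A graph is used because a
-- moveset need not be decidable, so the recursion need not be computable.
-- Classically every position has a value: it has finitely many options,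
-- and every move decreases the number or the size of the parts.
data Value (M : Moveset) (τ : ℕ) : 𝕐⁺ → ℕ → Set where
  terminal : ∀ {p} → Terminal M p → Value M τ p τ
  mex      : ∀ {p n} → ¬ Terminal M p →
             (v : Option M p → ℕ) →
             (∀ q (p→q : Move M p q) → Value M τ q (v (q , p→q))) →
             IsMex (λ m → ∃[ o ] v o ≡ m) n →
             Value M τ p n

SpragueGrundy : Moveset → 𝕐⁺ → ℕ → Set
SpragueGrundy M = Value M 0

MisèreGrundy : Moveset → 𝕐⁺ → ℕ → Set
MisèreGrundy M = Value M 1

value-unique : ∀ {M τ p m n} → Value M τ p m → Value M τ p n → m ≡ n
value-unique (terminal _)  (terminal _)    = refl
value-unique (terminal t)  (mex ¬t _ _ _)  = ⊥-elim (¬t t)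
value-unique (mex ¬t _ _ _) (terminal t)   = ⊥-elim (¬t t)
value-unique {m = m} {n} (mex _ v val (m∉ , <m)) (mex _ w wal (n∉ , <n))
  with <-cmp m n
... | tri≈ _ m≡n _ = m≡n
... | tri< m<n _ _ with <n m m<n
...   | (q , p→q) , w≡m =
        ⊥-elim (m∉ ((q , p→q) , trans (value-unique (val q p→q) (wal q p→q)) w≡m))
value-unique {m = m} {n} (mex _ v val (m∉ , <m)) (mex _ w wal (n∉ , <n))
    | tri> _ _ n<m with <m n n<m
...   | (q , p→q) , v≡n =
        ⊥-elim (n∉ ((q , p→q) , trans (sym (value-unique (val q p→q) (wal q p→q))) v≡n))

_⟨_,_⟩-position : Moveset → ℕ → ℕ → Pred 𝕐⁺ 0ℓ
(M ⟨ t , ℓ ⟩-position) p = SpragueGrundy M p t × MisèreGrundy M p ℓ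

ReturnableTo : ℕ → ℕ → Moveset → 𝕐⁺ → Set
ReturnableTo t ℓ M λ₀ =
  ∀ x y → x ∈ Position M λ₀ → x ∈ M ⟨ t , ℓ ⟩-position →
  Move M x y → ¬ Terminal M y →
  ∃[ z ] Move M y z × z ∈ M ⟨ t , ℓ ⟩-position

Returnable : Moveset → 𝕐⁺ → Set
Returnable M λ₀ = ReturnableTo 0 1 M λ₀ × ReturnableTo 1 0 M λ₀

Domestic : Moveset → 𝕐⁺ → Set
Domestic M λ₀ =
  ∀ p k → p ∈ Position M λ₀ → 2 ≤ k →
  p ∉ M ⟨ 0 , k ⟩-position × p ∉ M ⟨ k , 0 ⟩-position

FamilyFails : (Moveset → 𝕐⁺ → Set) → Moveset → Pred 𝕐⁺ 0ℓ → Set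
FamilyFails Property M P = ∃[ λ₀ ] λ₀ ∈ P × ¬ Property M λ₀

data KingCell : Pred (ℕ × ℕ) 0ℓ where
  right    : KingCell (0 , 1)
  down     : KingCell (1 , 0)
  diagonal : KingCell (1 , 1)

data RookCell : Pred (ℕ × ℕ) 0ℓ where
  down  : ∀ {k} → 1 ≤ k → RookCell (k , 0)
  right : ∀ {k} → 1 ≤ k → RookCell (0 , k)

data QueenCell : Pred (ℕ × ℕ) 0ℓ where
  down     : ∀ {k} → 1 ≤ k → QueenCell (k , 0)
  right    : ∀ {k} → 1 ≤ k → QueenCell (0 , k)
  diagonal : ∀ {k} → 1 ≤ k → QueenCell (k , k)

King Rook Queen : Moveset
King  = record { cells = KingCell  ; proper = λ () }
Rook  = record { cells = RookCell  ; proper = λ { (down ()) ; (right ()) } }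
Queen = record
  { cells = QueenCell ; proper = λ { (down ()) ; (right ()) ; (diagonal ()) } }

staircaseParts : (r c k : ℕ) → List ℕ
staircaseParts r c zero    = []
staircaseParts r c (suc k) = replicate r (suc k * c) ++ staircaseParts r c k

GeneralizedStaircase : Pred Partition 0ℓ
GeneralizedStaircase σ =
  ∃[ r ] ∃[ c ] ∃[ k ]
    1 ≤ r × 1 ≤ c × 1 ≤ k × parts σ ≡ staircaseParts r c k

StaircaseSubpartition : Pred 𝕐⁺ 0ℓ
StaircaseSubpartition μ =
  ∃[ σ ] GeneralizedStaircase σ × ∃[ i ] ∃[ j ] partition μ ≡ σ [ i , j ]

{-# OPTIONS --safe #-}

-- Each family fails on an explicit partition found by computer search.  All
-- options of λ[i,j] are among the λ[i',j'] with (i',j') lexicographically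
-- later, so both values of every position are computed in one pass from the
-- back of the list of all λ[i,j], without repeating the recursion.
module Submission where

open import Defs
open import Data.Empty using (⊥-elim-irr)
open import Data.List.Base
  using (List; []; _∷_; cartesianProduct; filter; length; map; upTo)
open import Data.List.Extrema.Nat using (max; xs≤max)
import Data.List.Membership.DecPropositional as DecMembership
open import Data.List.Membership.Propositional using (_∈_; _∉_)
open import Data.List.Membership.Propositional.Properties
  using (∈-map⁺; ∈-map⁻; ∈-filter⁺; ∈-filter⁻; ∈-cartesianProduct⁺; ∈-upTo⁺)
open import Data.List.Properties using (≡-dec; drop-all; filter-none)
open import Data.List.Relation.Unary.All as All using (All; all?; lookup)
open import Data.List.Relation.Unary.All.Properties as Allₚ using (drop⁺)
open import Data.List.Relation.Unary.Any using (here; there)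
open import Data.List.Relation.Unary.Linked using (linked?)
open import Data.Nat.Base
  using (ℕ; zero; suc; _+_; _∸_; _⊔_; _<_; _≤_; z≤n; s≤s; z<s)
open import Data.Nat.Properties
  using (_≟_; _<?_; _≤?_; _≥?_; ≤-trans; ≰⇒>; <-irrefl;
         m≤m⊔n; m≤n⊔m; m≤n⇒m∸n≡0; m≤n⇒m<n∨m≡n; +-identityʳ; +-suc)
open import Data.Product using (_×_; _,_; proj₁; proj₂; ∃-syntax)
open import Data.Sum.Base using (inj₁; inj₂)
open import Data.Unit.Base using (⊤; tt)
open import Function.Base using (_∘_)
open import Relation.Binary.Construct.Closure.ReflexiveTransitive using (ε)
open import Relation.Binary.PropositionalEquality
  using (_≡_; _≢_; refl; sym; trans; cong; subst)
open import Relation.Nullary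
  using (¬_; yes; no; ¬?; _×-dec_; contradiction)
open import Relation.Nullary.Decidable using (True; toWitness; map′)
open import Relation.Unary using (Decidable; U)

private
  variable
    m τ : ℕ
    ys : List ℕ
    xss : List (List ℕ)

-- Membership tests and the mex of a finite list.

open DecMembership _≟_ using (_∈?_)
open DecMembership (≡-dec _≟_) using () renaming (_∈?_ to _∈ₗ?_)

-- `f` is fuel for an upward search from `n`: the known non-member `n + f` stays fixed while `n`
-- grows, so the search stops there at the latest.
least : ∀ f n vs → n + f ∉ vs → (∀ m → m < n → m ∈ vs) → ∃[ t ] IsMex (_∈ vs) t
least f n vs n+f∉ below with n ∈? vs
... | no n∉ = n , n∉ , below
least zero n vs n+f∉ below | yes n∈ =
  contradiction (subst (_∈ vs) (sym (+-identityʳ n)) n∈) n+f∉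
least (suc f) n vs n+f∉ below | yes n∈ =
  least f (suc n) vs (n+f∉ ∘ subst (_∈ vs) (sym (+-suc n f))) below′
  where
  below′ : ∀ m → m < suc n → m ∈ vs
  below′ m (s≤s m≤n) with m≤n⇒m<n∨m≡n m≤n
  ... | inj₁ m<n  = below m m<n
  ... | inj₂ refl = n∈

mexOf : ∀ vs → ∃[ t ] IsMex (_∈ vs) t
-- One more than the maximum cannot occur in `vs`, so it bounds the search.
mexOf vs = least (suc (max 0 vs)) 0 vs
  (λ 1+max∈ → <-irrefl refl (lookup (xs≤max 0 vs) 1+max∈)) (λ _ ())

-- Nonempty shifts as a finite list.

parts≢[] : ∀ p → parts (partition p) ≢ []
-- The field `nonempty` is irrelevant, but it may still be used to derive falsehood.
parts≢[] (mk𝕐⁺ _ ne) eq = ⊥-elim-irr (ne eq)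

nonempty? : Decidable (λ (xs : List ℕ) → xs ≢ [])
nonempty? xs = ¬? (≡-dec _≟_ xs [])

-- A common bound for both coordinates: removing at least `length xs` rows or `max 0 xs` columns
-- leaves nothing.
size : List ℕ → ℕ
size xs = length xs ⊔ max 0 xs

shift≢[]⇒i<size : ∀ i j xs → shift i j xs ≢ [] → i < size xs
shift≢[]⇒i<size i j xs ne with size xs ≤? i
... | no  size≰i = ≰⇒> size≰i
... | yes size≤i = contradiction
  (cong (filter (0 <?_) ∘ map (_∸ j))
    (drop-all i xs (≤-trans (m≤m⊔n (length xs) _) size≤i))) ne

shift≢[]⇒j<size : ∀ i j xs → shift i j xs ≢ [] → j < size xs
shift≢[]⇒j<size i j xs ne with size xs ≤? j
... | no  size≰j = ≰⇒> size≰j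
... | yes size≤j = contradiction
  (filter-none (0 <?_) (Allₚ.map⁺ (All.map vanish (drop⁺ i (xs≤max 0 xs))))) ne
  where
  vanish : ∀ {x} → x ≤ max 0 xs → ¬ 0 < x ∸ j
  vanish x≤max 0<x∸j
    rewrite m≤n⇒m∸n≡0 (≤-trans x≤max (≤-trans (m≤n⊔m (length xs) _) size≤j))
    = <-irrefl refl 0<x∸j

cells<size : List ℕ → List (ℕ × ℕ)
cells<size xs = cartesianProduct (upTo (size xs)) (upTo (size xs))

shiftBy : List ℕ → ℕ × ℕ → List ℕ
shiftBy xs (i , j) = shift i j xs

nonemptyShifts : List ℕ → List (ℕ × ℕ) → List (List ℕ)
nonemptyShifts xs cs = filter nonempty? (map (shiftBy xs) cs)

∈-nonemptyShifts⁻ : ∀ xs cs → ys ∈ nonemptyShifts xs cs →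
                    ∃[ c ] c ∈ cs × ys ≢ [] × ys ≡ shiftBy xs c
∈-nonemptyShifts⁻ xs cs ys∈
  with ys∈map , ne ← ∈-filter⁻ nonempty? {xs = map (shiftBy xs) cs} ys∈
  with c , c∈ , eq ← ∈-map⁻ (shiftBy xs) ys∈map = c , c∈ , ne , eq

subpartitions : List ℕ → List (List ℕ)
subpartitions xs = nonemptyShifts xs (cells<size xs)

-- Tables of values.

evaluate : ℕ → List ℕ → ℕ
-- The mex of the empty list is 0, whereas a terminal position has misère value 1.
evaluate τ []         = τ
evaluate τ vs@(_ ∷ _) = proj₁ (mexOf vs)

Table : Set
Table = List (List ℕ × ℕ)

_!_ : Table → List ℕ → ℕ
-- This default is never reached while a table over a `Graded` list is built: every option looked up
-- has an entry further back.
[]            ! ys = 0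
((xs , v) ∷ T) ! ys with ≡-dec _≟_ ys xs
... | yes _ = v
... | no  _ = T ! ys

-- Correctness of the table for a decidable moveset.

module Analysis (M : Moveset) (cells? : Decidable (cells M)) where

  options : List ℕ → List (List ℕ)
  options xs = nonemptyShifts xs (filter cells? (cells<size xs))

  -- The target of a move is nonempty, which keeps both coordinates of the cell below `size`.
  move⇒option : ∀ p q → Move M p q →
                parts (partition q) ∈ options (parts (partition p))
  move⇒option p q (i , j , c , refl) =
    ∈-filter⁺ nonempty?
      (∈-map⁺ (shiftBy (parts (partition p))) (∈-filter⁺ cells?
        (∈-cartesianProduct⁺ (∈-upTo⁺ (shift≢[]⇒i<size i j _ ne))
                             (∈-upTo⁺ (shift≢[]⇒j<size i j _ ne)))
        c))
      ne
    where
    ne = parts≢[] q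

  option⇒move : ∀ p → ys ∈ options (parts (partition p)) →
                ∃[ q ] Move M p q × parts (partition q) ≡ ys
  option⇒move p ys∈
    with (i , j) , c∈ , ne , refl ← ∈-nonemptyShifts⁻ (parts (partition p)) _ ys∈
    with _ , c ← ∈-filter⁻ cells? {xs = cells<size (parts (partition p))} c∈ =
    mk𝕐⁺ (partition p [ i , j ]) ne , (i , j , c , refl) , refl

  options⇒¬terminal : ∀ p → options (parts (partition p)) ≢ [] → ¬ Terminal M p
  options⇒¬terminal p ne term with options (parts (partition p)) in eq
  ... | []     = ne refl
  ... | ys ∷ _ =
    let q , p→q , _ = option⇒move p (subst (ys ∈_) (sym eq) (here refl)) in term q p→q

  -- The order condition that lets a table be filled from the back.
  Graded : List (List ℕ) → Set
  Graded []         = ⊤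
  Graded (xs ∷ xss) = All (_∈ xss) (options xs) × Graded xss

  graded? : Decidable Graded
  graded? []         = yes tt
  graded? (xs ∷ xss) = all? (_∈ₗ? xss) (options xs) ×-dec graded? xss

  self-graded? : Decidable (λ xs → xs ∈ subpartitions xs × Graded (subpartitions xs))
  self-graded? xs = (xs ∈ₗ? subpartitions xs) ×-dec graded? (subpartitions xs)

  graded-closed : ∀ {xs} → Graded xss → xs ∈ xss → ys ∈ options xs → ys ∈ xss
  graded-closed (opts , _) (here refl) ys∈ = there (lookup opts ys∈)
  graded-closed (_ , g)    (there xs∈) ys∈ = there (graded-closed g xs∈ ys∈)

  -- T is a separate argument so that its two occurrences share one evaluation.
  extend : ℕ → List ℕ → Table → Table
  extend τ xs T = (xs , evaluate τ (map (T !_) (options xs))) ∷ T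

  table : ℕ → List (List ℕ) → Table
  table τ []         = []
  table τ (xs ∷ xss) = extend τ xs (table τ xss)

  -- Moves and listed options correspond in both directions, so both halves of the mex condition
  -- transfer; an empty list of options means a terminal position.
  evaluate-value : ∀ (f : List ℕ → ℕ) p →
    (∀ q → Move M p q → Value M τ q (f (parts (partition q)))) →
    Value M τ p (evaluate τ (map f (options (parts (partition p)))))
  evaluate-value f p val
    with options (parts (partition p)) in eq
  ... | [] = terminal λ q p→q →
      contradiction (subst (_ ∈_) eq (move⇒option p q p→q)) λ ()
  ... | ys ∷ yss =
    mex (options⇒¬terminal p λ none → contradiction (trans (sym eq) none) λ ())
      (λ (q , _) → f (parts (partition q))) val
      (t∉ ∘ option∈ , λ m m<t → ∈option (below m m<t))
    where
    vs = map f (ys ∷ yss)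
    t∉ = proj₁ (proj₂ (mexOf vs))
    below = proj₂ (proj₂ (mexOf vs))

    option∈ : ∃[ o ] f (parts (partition (proj₁ {B = Move M p} o))) ≡ m → m ∈ vs
    option∈ ((q , p→q) , refl) = ∈-map⁺ f (subst (_ ∈_) eq (move⇒option p q p→q))

    ∈option : m ∈ vs → ∃[ o ] f (parts (partition (proj₁ {B = Move M p} o))) ≡ m
    ∈option m∈ with ∈-map⁻ f m∈
    ... | zs , zs∈ , refl with option⇒move p (subst (zs ∈_) (sym eq) zs∈)
    ... | q , p→q , refl = (q , p→q) , refl

  -- Induction on the list: the options of the head all have entries in the tail. A repeated list is
  -- read off at its first occurrence, whose entry is correct too.
  table-value : ∀ xss → Graded xss → ∀ p → parts (partition p) ∈ xss →
                Value M τ p (table τ xss ! parts (partition p))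
  table-value {τ} (xs ∷ xss) (opts , g) p p∈ with ≡-dec _≟_ (parts (partition p)) xs
  ... | yes refl = evaluate-value (table τ xss !_) p
    λ q p→q → table-value xss g q (lookup opts (move⇒option p q p→q))
  table-value (xs ∷ xss) (opts , g) p (here p≡xs) | no p≢xs = contradiction p≡xs p≢xs
  table-value (xs ∷ xss) (opts , g) p (there p∈)  | no _    = table-value xss g p p∈

  -- For a concrete partition the type of `check` reduces to the unit type, so gradedness is
  -- established by evaluation.
  module Checked (λ₀ : 𝕐⁺)
    (check : True (self-graded? (parts (partition λ₀)))) where

    S : List (List ℕ)
    S = subpartitions (parts (partition λ₀))

    λ₀∈S : parts (partition λ₀) ∈ S
    λ₀∈S = proj₁ (toWitness check)

    S-graded : Graded S
    S-graded = proj₂ (toWitness check)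

    grundy : ℕ → List ℕ → ℕ
    grundy τ xs = table τ S ! xs

    grundy-value : ∀ p → parts (partition p) ∈ S →
                   Value M τ p (grundy τ (parts (partition p)))
    grundy-value = table-value S S-graded

    position : ∀ t ℓ → grundy 0 (parts (partition λ₀)) ≡ t →
               grundy 1 (parts (partition λ₀)) ≡ ℓ → (M ⟨ t , ℓ ⟩-position) λ₀
    position _ _ refl refl = grundy-value λ₀ λ₀∈S , grundy-value λ₀ λ₀∈S

    avoids? : ∀ t ℓ → Decidable (λ zs → ¬ (grundy 0 zs ≡ t × grundy 1 zs ≡ ℓ))
    avoids? t ℓ zs = ¬? ((grundy 0 zs ≟ t) ×-dec (grundy 1 zs ≟ ℓ))

    -- The starting partition itself serves as the position moved from. By `value-unique`, the table
    -- entries rule out every possible reply from `y`.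
    no-return : ∀ {t ℓ} y → (M ⟨ t , ℓ ⟩-position) λ₀ → Move M λ₀ y →
                options (parts (partition y)) ≢ [] →
                True (all? (avoids? t ℓ) (options (parts (partition y)))) →
                ¬ ReturnableTo t ℓ M λ₀
    no-return {t} {ℓ} y λ₀-pos λ₀→y y-moves y-avoids return
      with return λ₀ y ε λ₀-pos λ₀→y (options⇒¬terminal y y-moves)
    ... | z , y→z , sg , mis =
      lookup (toWitness y-avoids) z∈
        (value-unique (grundy-value z z∈S) sg , value-unique (grundy-value z z∈S) mis)
      where
      z∈ = move⇒option y z y→z
      -- `z` is two moves away from `λ₀`, hence two uses of closure.
      z∈S = graded-closed S-graded
        (graded-closed S-graded λ₀∈S (move⇒option λ₀ y λ₀→y)) z∈

-- The three movesets and their failing partitions.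

fromParts : ∀ xs → True (linked? _≥?_ xs) → True (all? (0 <?_) xs) → Partition
fromParts xs xs↓ xs+ = mkPartition xs (toWitness xs↓) (toWitness xs+)

rookCell? : Decidable RookCell
rookCell? (zero  , zero)  = no λ { (down ()) ; (right ()) }
rookCell? (zero  , suc _) = yes (right z<s)
rookCell? (suc _ , zero)  = yes (down z<s)
rookCell? (suc _ , suc _) = no λ ()

queenCell? : Decidable QueenCell
queenCell? (zero  , zero)  = no (proper Queen)
queenCell? (zero  , suc _) = yes (right z<s)
queenCell? (suc _ , zero)  = yes (down z<s)
queenCell? (suc i , suc j) =
  map′ (λ { refl → diagonal z<s }) (λ { (diagonal _) → refl }) (i ≟ j)

kingCell? : Decidable KingCell
kingCell? (0 , 0)           = no λ ()
kingCell? (0 , 1)           = yes right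
kingCell? (1 , 0)           = yes down
kingCell? (1 , 1)           = yes diagonal
kingCell? (0 , suc (suc _)) = no λ ()
kingCell? (1 , suc (suc _)) = no λ ()
kingCell? (suc (suc _) , _) = no λ ()

module R = Analysis Rook rookCell?
module Q = Analysis Queen queenCell?
module K = Analysis King kingCell?

rook-undomestic : FamilyFails Domestic Rook U
rook-undomestic = λ₀ , tt , λ domestic →
  -- Each `refl` evaluates a table, one with terminal value 0 and one with terminal value 1.
  proj₂ (domestic λ₀ 4 ε (s≤s (s≤s z≤n))) (position 4 0 refl refl)
  where
  λ₀ = mk𝕐⁺ (fromParts (5 ∷ 4 ∷ 4 ∷ 4 ∷ []) _ _) λ ()
  open R.Checked λ₀ _

rook-unreturnable : FamilyFails Returnable Rook U
rook-unreturnable = λ₀ , tt , λ (_ , returnable₁₀) →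
  -- Removing the first row leaves a 4 by 5 rectangle, which is Nim with piles 3 and 4. One more
  -- move leaves a pile of at least 3, but a (1,0)-position of two-pile Nim has piles 0 and 1.
  no-return (mk𝕐⁺ (partition λ₀ [ 1 , 0 ]) λ ()) (position 1 0 refl refl)
    (1 , 0 , down z<s , refl) (λ ()) _ returnable₁₀
  where
  λ₀ = mk𝕐⁺ (fromParts (6 ∷ 5 ∷ 5 ∷ 5 ∷ 5 ∷ []) _ _) λ ()
  open R.Checked λ₀ _

queen-undomestic : FamilyFails Domestic Queen U
queen-undomestic = λ₀ , tt , λ domestic →
  -- Here it is the exclusion of (0,k)-positions that fails.
  proj₁ (domestic λ₀ 11 ε (s≤s (s≤s z≤n))) (position 0 11 refl refl)
  where
  λ₀ = mk𝕐⁺ (fromParts (8 ∷ 8 ∷ 8 ∷ 8 ∷ 8 ∷ 2 ∷ []) _ _) λ ()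
  open Q.Checked λ₀ _

queen-unreturnable : FamilyFails Returnable Queen U
queen-unreturnable = λ₀ , tt , λ (_ , returnable₁₀) →
  no-return (mk𝕐⁺ (partition λ₀ [ 1 , 0 ]) λ ()) (position 1 0 refl refl)
    (1 , 0 , down z<s , refl) (λ ()) _ returnable₁₀
  where
  λ₀ = mk𝕐⁺ (fromParts (9 ∷ 9 ∷ 9 ∷ 9 ∷ 9 ∷ 3 ∷ []) _ _) λ ()
  open Q.Checked λ₀ _

-- This is [8,8,8,4,4,4]; removing three columns or one row gives the two failing partitions.
staircase : Partition
staircase = fromParts (staircaseParts 3 4 2) _ _

staircase-generalized : GeneralizedStaircase staircase
staircase-generalized = 3 , 4 , 2 , z<s , z<s , z<s , refl

-- λ₀ = [5,5,5,1,1,1]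
king-undomestic : FamilyFails Domestic King StaircaseSubpartition
king-undomestic = λ₀ , (staircase , staircase-generalized , 0 , 3 , refl) , λ domestic →
  proj₂ (domestic λ₀ 3 ε (s≤s (s≤s z≤n))) (position 3 0 refl refl)
  where
  λ₀ = mk𝕐⁺ (staircase [ 0 , 3 ]) λ ()
  open K.Checked λ₀ _

-- λ₀ = [8,8,4,4,4]
king-unreturnable : FamilyFails Returnable King StaircaseSubpartition
king-unreturnable =
  λ₀ , (staircase , staircase-generalized , 1 , 0 , refl) , λ (_ , returnable₁₀) →
  -- The move leads to [8,4,4,4], whose only options are [7,3,3,3], [4,4,4] and [3,3,3].
  no-return (mk𝕐⁺ (partition λ₀ [ 1 , 0 ]) λ ()) (position 1 0 refl refl)
    (1 , 0 , down , refl) (λ ()) _ returnable₁₀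
  where
  λ₀ = mk𝕐⁺ (staircase [ 1 , 0 ]) λ ()
  open K.Checked λ₀ _

theorem4p15 : (FamilyFails Domestic Rook U × FamilyFails Returnable Rook U)
    × (FamilyFails Domestic Queen U × FamilyFails Returnable Queen U)
    × (FamilyFails Domestic King StaircaseSubpartition
    × FamilyFails Returnable King StaircaseSubpartition)
theorem4p15 =
  (rook-undomestic , rook-unreturnable) ,
  (queen-undomestic , queen-unreturnable) ,
  (king-undomestic , king-unreturnable)
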